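{- Let $G=(V,E)$ be a finite simple graph with $n$ vertices, $e$ edges, minimum degree $\delta \geq 1$, maximum degree $\Delta$, and independence number $\beta$. Then each of the following five inequalities holds, and in each of them equality holds if and only if $G$ is a regular balanced bipartite graph: [1] $$Z_1(G) \leq (n - \beta) \Delta^2 + \frac{e^2}{2 \beta} + \frac{\beta \Delta^3}{2 \delta};$$ [2] $$F(G) \geq (n - \beta) \delta^3 + \frac{\delta (2 \beta^2 \delta^2 - e^2)}{\beta};$$ [3] $$F(G) \geq (n - \beta) \delta^3 + \frac{\delta}{\beta} \left( 2 \beta \left(\beta \delta^2 + \frac{e^2}{n - \beta}\right) - e^2 - 2 \beta (n - \beta) \Delta^2\right);$$ [4] $$Inv(G) \geq \frac{n - \beta}{\Delta} + \frac{2 \beta^2 \delta^2 - e^2}{\beta \Delta^3};$$ [5] $$Inv(G) \geq \frac{n - \beta}{\Delta} + \frac{1}{\beta \Delta^3} \left( 2 \beta \left(\beta \delta^2 + \frac{e^2}{n - \beta}\right) - e^2 - 2 \beta (n - \beta) \Delta^2\right).$$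
   Context: Graphs are finite, undirected, without loops or multiple edges. $d(u)$ denotes the degree of vertex $u$; $\delta$ and $\Delta$ are the minimum and maximum degrees. The independence number $\beta$ is the maximum size of a set of pairwise nonadjacent vertices. The first Zagreb index is $Z_1(G)=\sum_{u\in V} d(u)^2$, the forgotten topological index is $F(G)=\sum_{u\in V} d(u)^3$, and (when $\delta\ge 1$) the inverse degree is $Inv(G)=\sum_{u\in V}\frac{1}{d(u)}$. A regular balanced bipartite graph is a bipartite graph whose two parts have equal size and in which all vertices have the same degree. -}

module Defs where

open import Algebra.Properties.CommutativeMonoid.Sum using (sum)
open import Data.Bool.Base using (_∧_)
open import Data.Fin.Base using (Fin)
open import Data.Fin.Properties using (_<?_)
open import Data.Fin.Subset using (Subset; _∈_; _∉_; ∣_∣; ∁; ⁅_⁆)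
open import Data.Fin.Subset.Properties using (nonempty?; Empty-unique; ∣⊥∣≡0; ∣⁅x⁆∣≡1; x∈⁅y⁆⇒x≡y; ∣p∣≤n; ∣p∣≡n⇒p≡⊤; ∈⊤)
open import Data.Integer.Base using (+_)
open import Data.Nat.Base as ℕ using (ℕ; _≤_; _^_; _∸_; NonZero; >-nonZero)
import Data.Nat.Properties as ℕₚ
open import Data.Product.Base using (_×_; _,_; ∃-syntax; proj₁; proj₂)
open import Data.Rational.Base as ℚ using (ℚ; _/_)
import Data.Rational.Properties as ℚₚ
open import Data.Sum.Base using (_⊎_)
open import Data.Vec.Base using (tabulate)
open import Data.Vec.Properties using ([]=⇒lookup; lookup∘tabulate)
open import Level using (0ℓ)
open import Relation.Binary.Core using (Rel)
open import Relation.Binary.Definitions using (Symmetric; Irreflexive; Decidable)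
open import Relation.Binary.PropositionalEquality using (_≡_; refl; sym; trans; cong; subst)
open import Relation.Nullary using (¬_; does; yes; no; contradiction)

record SimpleGraph (n : ℕ) : Set₁ where
  infix 4 _~_ _~?_
  field
    _~_      : Rel (Fin n) 0ℓ
    _~?_     : Decidable _~_
    ~-sym    : Symmetric _~_
    ~-irrefl : Irreflexive _≡_ _~_

module _ {n : ℕ} (G : SimpleGraph n) where
  open SimpleGraph G

  neighbourhood : Fin n → Subset n
  neighbourhood u = tabulate λ v → does (u ~? v)

  degree : Fin n → ℕ
  degree u = ∣ neighbourhood u ∣

  -- Each edge {u , v} is counted once, at its smaller endpoint.
  numEdges : ℕ
  numEdges = sum ℕₚ.+-0-commutativeMonoid λ u →
    ∣ tabulate (λ v → does (u <? v) ∧ does (u ~? v)) ∣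

  IsMinDegree : ℕ → Set
  IsMinDegree δ = (∃[ u ] degree u ≡ δ) × (∀ u → δ ≤ degree u)

  IsMaxDegree : ℕ → Set
  IsMaxDegree Δ = (∃[ u ] degree u ≡ Δ) × (∀ u → degree u ≤ Δ)

  Independent : Subset n → Set
  Independent S = ∀ {u v} → u ∈ S → v ∈ S → ¬ (u ~ v)

  IsIndependenceNumber : ℕ → Set
  IsIndependenceNumber β =
    (∃[ S ] Independent S × ∣ S ∣ ≡ β) × (∀ S → Independent S → ∣ S ∣ ≤ β)

  firstZagreb : ℕ
  firstZagreb = sum ℕₚ.+-0-commutativeMonoid λ u → degree u ^ 2

  forgotten : ℕ
  forgotten = sum ℕₚ.+-0-commutativeMonoid λ u → degree u ^ 3

  inverseDegree : .(∀ u → NonZero (degree u)) → ℚ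
  inverseDegree d≢0 = sum ℚₚ.+-0-commutativeMonoid λ u →
    _/_ (+ 1) (degree u) {{d≢0 u}}

  Regular : Set
  Regular = ∃[ k ] (∀ u → degree u ≡ k)

  -- The two parts are S and its complement.
  IsBipartition : Subset n → Set
  IsBipartition S = ∀ {u v} → u ~ v → (u ∈ S × v ∉ S) ⊎ (u ∉ S × v ∈ S)

  BalancedBipartite : Set
  BalancedBipartite = ∃[ S ] IsBipartition S × ∣ S ∣ ≡ ∣ ∁ S ∣

  RegularBalancedBipartite : Set
  RegularBalancedBipartite = Regular × BalancedBipartite

ι : ℕ → ℚ
ι k = + k / 1

infixl 7 _÷ℕ_
_÷ℕ_ : ℚ → (d : ℕ) → .{{NonZero d}} → ℚ
p ÷ℕ d = p ℚ.* (+ 1 / d)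

-- When 1 ≤ δ, none of the quantities used as denominators vanishes.
module _ {n : ℕ} (G : SimpleGraph n) {δ : ℕ} (minδ : IsMinDegree G δ) (1≤δ : 1 ≤ δ) where
  open SimpleGraph G

  δ≢0 : NonZero δ
  δ≢0 = >-nonZero 1≤δ

  degree≢0 : ∀ u → NonZero (degree G u)
  degree≢0 u = >-nonZero (ℕₚ.≤-trans 1≤δ (proj₂ minδ u))

  Δ≢0 : ∀ {Δ} → IsMaxDegree G Δ → NonZero Δ
  Δ≢0 ((u , refl) , _) = degree≢0 u

  β≢0 : ∀ {β} → IsIndependenceNumber G β → NonZero β
  β≢0 (_ , max) = >-nonZero (subst (_≤ _) (∣⁅x⁆∣≡1 u) (max ⁅ u ⁆ indep))
    where
    u = proj₁ (proj₁ minδ)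
    indep : Independent G ⁅ u ⁆
    indep a b = ~-irrefl (trans (x∈⁅y⁆⇒x≡y u a) (sym (x∈⁅y⁆⇒x≡y u b)))

  private
    neighbour : ∀ u → ∃[ v ] (u ~ v)
    neighbour u with nonempty? (neighbourhood G u)
    ... | no empty = contradiction
            (trans (cong ∣_∣ (Empty-unique empty)) (∣⊥∣≡0 n))
            (ℕ.≢-nonZero⁻¹ _ {{degree≢0 u}})
    ... | yes (v , v∈) with u ~? v | trans (sym (lookup∘tabulate (λ w → does (u ~? w)) v)) ([]=⇒lookup v∈)
    ...   | yes u~v | _ = v , u~v
    ...   | no _    | ()

  n∸β≢0 : ∀ {β} → IsIndependenceNumber G β → NonZero (n ∸ β)
  n∸β≢0 ((S , indep , refl) , _) =
    >-nonZero (ℕₚ.m<n⇒0<n∸m (ℕₚ.≤∧≢⇒< (∣p∣≤n S) λ ∣S∣≡n →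
      let u       = proj₁ (proj₁ minδ)
          v , u~v = neighbour u
          in-S    = λ w → subst (w ∈_) (sym (∣p∣≡n⇒p≡⊤ ∣S∣≡n)) ∈⊤
      in indep (in-S u) (in-S v) u~v))

{-# OPTIONS --safe #-}
module Submission where

-- Let S be a maximum independent set.  Every edge at S leads to the complement of S, so the degree
-- sum over S is at most e and the one over the complement at least e; hence β δ ≤ e ≤ (n − β) Δ.
-- [1]: Z₁ ≤ (n − β) Δ² + e Δ, and e Δ ≤ e² / 2β + β Δ² / 2 ≤ e² / 2β + β Δ³ / 2δ by AM-GM.
-- [2], [4]: e ≥ β δ gives 2 β² δ² − e² ≤ β² δ², which reduces them to F ≥ n δ³ and Inv ≥ n / Δ.
-- [3], [5] follow from [2], [4], since e ≤ (n − β) Δ makes their bracket the smaller one.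
-- Equality always forces δ = Δ and e = β δ, so that both degree sums equal e: then no edge lies
-- inside the complement of S, and S and its complement have the same size.

open import Defs
import Data.Integer.Base as ℤ
import Data.Integer.Properties as ℤₚ
import Data.Nat.Properties as ℕₚ
import Data.Rational.Unnormalised.Properties as ℚᵘₚ
open import Data.Bool.Base using (Bool; true; false; not; _∧_)
open import Data.Fin.Base using (Fin; zero; suc)
open import Data.Fin.Properties using (_<?_) renaming (<-cmp to <-cmpF)
open import Data.Fin.Subset using (Subset; _∈_; _∉_; ∣_∣; ∁)
open import Data.Fin.Subset.Properties using (∣∁p∣≡n∸∣p∣; ∣p∣≤n)
open import Data.Nat.Base as ℕ using (ℕ; zero; suc; _∸_; _^_; NonZero) renaming (_≤_ to _≤ℕ_; _*_ to _*ℕ_; _+_ to _+ℕ_)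
open import Data.Nat.Tactic.RingSolver using (solve-∀)
open import Data.Product.Base using (_×_; _,_; proj₁; proj₂)
open import Data.Sum.Base using (_⊎_; inj₁; inj₂)
open import Data.Vec.Base using (tabulate; lookup)
open import Data.Vec.Properties using ([]=⇒lookup; lookup⇒[]=; tabulate∘lookup; lookup-map)
open import Function.Base using (_∘_; _$_)
open import Function.Bundles using (_⇔_; mk⇔; Equivalence)
open import Relation.Binary.Definitions using (tri<; tri≈; tri>)
open import Relation.Binary.PropositionalEquality using (_≡_; refl; sym; trans; cong; cong₂; subst; subst₂; module ≡-Reasoning)
open import Relation.Nullary using (does; yes; no; contradiction)
open import Relation.Nullary.Decidable using (dec-true; dec-false)

-- Finite sums over ℕ and set sizes as sums of indicators.

module DegreeCounting where

  open import Algebra.Properties.Semiring.Sum ℕₚ.+-*-semiring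
  open import Data.Nat.Base using (_+_; _*_; _≤_; z≤n)
  open import Data.Nat.Properties hiding (_<?_)

  ∑-mono-≤ : ∀ {n} {f g : Fin n → ℕ} → (∀ i → f i ≤ g i) → sum f ≤ sum g
  ∑-mono-≤ {zero}  f≤g = z≤n
  ∑-mono-≤ {suc n} f≤g = +-mono-≤ (f≤g zero) (∑-mono-≤ (f≤g ∘ suc))

  -- Slack in one summand cannot be made up by the other. Equality cases are traced back to single
  -- vertices or pairs of vertices in this way.
  +-mono-≤-tight : ∀ {a b c d} → a ≤ c → b ≤ d → a + b ≡ c + d → a ≡ c × b ≡ d
  +-mono-≤-tight {a} {b} {c} {d} a≤c b≤d eq = a≡c , +-cancelˡ-≡ a b d (trans eq (cong (_+ d) (sym a≡c)))
    where
    a≡c : a ≡ c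
    a≡c = ≤-antisym a≤c $ +-cancelʳ-≤ d c a $ ≤-trans (≤-reflexive (sym eq)) (+-monoʳ-≤ a b≤d)

  ∑-mono-≤-tight : ∀ {n} {f g : Fin n → ℕ} → (∀ i → f i ≤ g i) → sum f ≡ sum g → ∀ i → f i ≡ g i
  ∑-mono-≤-tight f≤g eq zero    = proj₁ (+-mono-≤-tight (f≤g zero) (∑-mono-≤ (f≤g ∘ suc)) eq)
  ∑-mono-≤-tight f≤g eq (suc i) = ∑-mono-≤-tight (f≤g ∘ suc) (proj₂ (+-mono-≤-tight (f≤g zero) (∑-mono-≤ (f≤g ∘ suc)) eq)) i

  ∑-const : ∀ n c → sum {n} (λ _ → c) ≡ n * c
  ∑-const zero    c = refl
  ∑-const (suc n) c = cong (c +_) (∑-const n c)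

  bit : Bool → ℕ
  bit true  = 1
  bit false = 0

  ∣tabulate∣≡∑ : ∀ {n} (b : Fin n → Bool) → ∣ tabulate b ∣ ≡ sum (bit ∘ b)
  ∣tabulate∣≡∑ {zero}  b = refl
  ∣tabulate∣≡∑ {suc n} b with b zero
  ... | true  = cong suc (∣tabulate∣≡∑ (b ∘ suc))
  ... | false = ∣tabulate∣≡∑ (b ∘ suc)

  ∣S∣≡∑ : ∀ {n} (S : Subset n) → ∣ S ∣ ≡ ∑[ u < n ] bit (lookup S u)
  ∣S∣≡∑ S = trans (cong ∣_∣ (sym (tabulate∘lookup S))) (∣tabulate∣≡∑ (lookup S))

  ∣∁S∣≡∑ : ∀ {n} (S : Subset n) → ∣ ∁ S ∣ ≡ ∑[ u < n ] bit (not (lookup S u))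
  ∣∁S∣≡∑ S = trans (∣S∣≡∑ (∁ S)) (sum-cong-≗ (λ u → cong bit (lookup-map u not S)))

  bit-split : ∀ b x → bit b * x + bit (not b) * x ≡ x
  bit-split true  x = trans (+-identityʳ (x + 0)) (+-identityʳ x)
  bit-split false x = +-identityʳ x

  lookup⇒∉ : ∀ {n} {S : Subset n} {u} → lookup S u ≡ false → u ∉ S
  lookup⇒∉ eq u∈S with () ← trans (sym eq) ([]=⇒lookup u∈S)

  -- Adjacency, the handshake identity and degree sums over vertex sets.

  module _ {n : ℕ} (G : SimpleGraph n) where
    open SimpleGraph G

    adj : Fin n → Fin n → ℕ
    adj u v = bit (does (u ~? v))

    adj-sym : ∀ u v → adj u v ≡ adj v u
    adj-sym u v with u ~? v | v ~? u
    ... | yes _   | yes _   = refl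
    ... | no _    | no _    = refl
    ... | yes u~v | no v≁u  = contradiction (~-sym u~v) v≁u
    ... | no u≁v  | yes v~u = contradiction (~-sym v~u) u≁v

    degree≡∑adj : ∀ u → degree G u ≡ ∑[ v < n ] adj u v
    degree≡∑adj u = ∣tabulate∣≡∑ (λ v → does (u ~? v))

    -- The indicator that `numEdges` sums: of the two orientations of an edge, only the increasing
    -- one counts.
    ordered : Fin n → Fin n → ℕ
    ordered u v = bit (does (u <? v) ∧ does (u ~? v))

    -- By trichotomy at most one orientation survives; on the diagonal both sides vanish by
    -- irreflexivity.
    adj-ordered : ∀ u v → adj u v ≡ ordered u v + ordered v u
    adj-ordered u v with <-cmpF u v
    ... | tri< u<v _ v≮u rewrite dec-true (u <? v) u<v | dec-false (v <? u) v≮u =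
      sym (+-identityʳ _)
    ... | tri> u≮v _ v<u rewrite dec-false (u <? v) u≮v | dec-true (v <? u) v<u = adj-sym u v
    ... | tri≈ u≮v refl _ rewrite dec-false (u <? u) u≮v | dec-false (u ~? u) (~-irrefl refl) = refl

    -- Each adjacency splits into its two orientations, and interchanging the sums turns the second
    -- orientation into another copy of the first.
    handshake : ∑[ u < n ] degree G u ≡ numEdges G + numEdges G
    handshake = begin
      ∑[ u < n ] degree G u
        ≡⟨ sum-cong-≗ degree≡∑adj ⟩
      ∑[ u < n ] ∑[ v < n ] adj u v
        ≡⟨ sum-cong-≗ (λ u → sum-cong-≗ (adj-ordered u)) ⟩
      ∑[ u < n ] ∑[ v < n ] (ordered u v + ordered v u)
        ≡⟨ sum-cong-≗ (λ u → ∑-distrib-+ (ordered u) (λ v → ordered v u)) ⟩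
      ∑[ u < n ] (∑[ v < n ] ordered u v + ∑[ v < n ] ordered v u)
        ≡⟨ ∑-distrib-+ (λ u → ∑[ v < n ] ordered u v) (λ u → ∑[ v < n ] ordered v u) ⟩
      E + ∑[ u < n ] ∑[ v < n ] ordered v u
        ≡⟨ cong (E +_) (∑-comm (λ u v → ordered v u)) ⟩
      E + E
        ≡⟨ cong₂ _+_ E≡ E≡ ⟩
      numEdges G + numEdges G ∎
      where
      open ≡-Reasoning
      E : ℕ
      E = ∑[ u < n ] ∑[ v < n ] ordered u v
      E≡ : E ≡ numEdges G
      E≡ = sum-cong-≗ λ u → sym (∣tabulate∣≡∑ (λ v → does (u <? v) ∧ does (u ~? v)))

    -- The degree sum over `S`, taken over all vertices with weights 0 and 1 so that `S` and its
    -- complement can be compared and added vertex by vertex.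
    volume : Subset n → ℕ
    volume S = ∑[ u < n ] (bit (lookup S u) * degree G u)

    volume-∁ : ∀ S → volume S + volume (∁ S) ≡ numEdges G + numEdges G
    volume-∁ S = begin
      volume S + volume (∁ S)
        ≡⟨ ∑-distrib-+ (λ u → bit (lookup S u) * degree G u) _ ⟨
      ∑[ u < n ] (bit (lookup S u) * degree G u + bit (lookup (∁ S) u) * degree G u)
        ≡⟨ sum-cong-≗ (λ u → cong (λ b → bit (lookup S u) * degree G u + bit b * degree G u) (lookup-map u not S)) ⟩
      ∑[ u < n ] (bit (lookup S u) * degree G u + bit (not (lookup S u)) * degree G u)
        ≡⟨ sum-cong-≗ (λ u → bit-split (lookup S u) (degree G u)) ⟩
      ∑[ u < n ] degree G u
        ≡⟨ handshake ⟩
      numEdges G + numEdges G ∎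
      where open ≡-Reasoning

    volume≡∑∑ : ∀ S → volume S ≡ ∑[ u < n ] ∑[ v < n ] (bit (lookup S u) * adj u v)
    volume≡∑∑ S = sum-cong-≗ λ u →
      trans (cong (bit (lookup S u) *_) (degree≡∑adj u)) (*-distribˡ-sum (bit (lookup S u)) (adj u))

    ∣S∣*c≡∑ : ∀ (S : Subset n) c → ∣ S ∣ * c ≡ ∑[ u < n ] (bit (lookup S u) * c)
    ∣S∣*c≡∑ S c = trans (cong (_* c) (∣S∣≡∑ S)) (*-distribʳ-sum c (bit ∘ lookup S))

    volume-≥ : ∀ S {δ} → (∀ u → δ ≤ degree G u) → ∣ S ∣ * δ ≤ volume S
    volume-≥ S {δ} δ≤ = ≤-trans (≤-reflexive (∣S∣*c≡∑ S δ)) (∑-mono-≤ λ u → *-monoʳ-≤ (bit (lookup S u)) (δ≤ u))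

    volume-≤ : ∀ S {Δ} → (∀ u → degree G u ≤ Δ) → volume S ≤ ∣ S ∣ * Δ
    volume-≤ S {Δ} ≤Δ = ≤-trans (∑-mono-≤ λ u → *-monoʳ-≤ (bit (lookup S u)) (≤Δ u)) (≤-reflexive (sym (∣S∣*c≡∑ S Δ)))

    -- An independent set against its complement.

    module _ {S : Subset n} (indep : Independent G S) where

      -- If `u` lies in `S` and is adjacent to `v`, independence puts `v` in the complement. So a
      -- pair counted at `u` on the left is counted at `v` on the right.
      endpoint-≤ : ∀ u v → bit (lookup S u) * adj u v ≤ bit (lookup (∁ S) v) * adj v u
      endpoint-≤ u v with lookup S u in u∈
      ... | false = z≤n
      ... | true with lookup S v in v∈
      ...   | false rewrite lookup-map v not S | v∈ | adj-sym u v = ≤-refl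
      ...   | true rewrite dec-false (u ~? v) (indep (lookup⇒[]= u S u∈) (lookup⇒[]= v S v∈)) = z≤n

      -- The sums are interchanged so that each pair is charged to its second vertex, as on the
      -- right of `endpoint-≤`.
      volume≡∑∑′ : volume (∁ S) ≡ ∑[ u < n ] ∑[ v < n ] (bit (lookup (∁ S) v) * adj v u)
      volume≡∑∑′ = trans (volume≡∑∑ (∁ S)) (∑-comm (λ u v → bit (lookup (∁ S) u) * adj u v))

      volume≤volume-∁ : volume S ≤ volume (∁ S)
      volume≤volume-∁ = begin
        volume S                                                 ≡⟨ volume≡∑∑ S ⟩
        ∑[ u < n ] ∑[ v < n ] (bit (lookup S u) * adj u v)       ≤⟨ ∑-mono-≤ (λ u → ∑-mono-≤ (endpoint-≤ u)) ⟩
        ∑[ u < n ] ∑[ v < n ] (bit (lookup (∁ S) v) * adj v u)   ≡⟨ volume≡∑∑′ ⟨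
        volume (∁ S)                                             ∎
        where open ≤-Reasoning

      -- Equal volumes force equality in `endpoint-≤` for every pair. On an edge both adjacency bits
      -- are 1, so what remains says that exactly one endpoint lies in `S`.
      tight⇒bipartition : volume S ≡ volume (∁ S) → IsBipartition G S
      tight⇒bipartition eq {u} {v} u~v = split (lookup S u) (lookup S v) refl refl opposite
        where
        tight : ∀ u v → bit (lookup S u) * adj u v ≡ bit (lookup (∁ S) v) * adj v u
        tight u = ∑-mono-≤-tight (endpoint-≤ u)
          (∑-mono-≤-tight (λ u → ∑-mono-≤ (endpoint-≤ u)) (trans (sym (volume≡∑∑ S)) (trans eq volume≡∑∑′)) u)
        opposite : bit (lookup S u) * 1 ≡ bit (not (lookup S v)) * 1
        opposite = subst₂ (λ x y → bit (lookup S u) * x ≡ bit (not (lookup S v)) * y)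
          (cong bit (dec-true (u ~? v) u~v)) (cong bit (dec-true (v ~? u) (~-sym u~v)))
          (trans (tight u v) (cong (λ b → bit b * adj v u) (lookup-map v not S)))
        split : ∀ b c → lookup S u ≡ b → lookup S v ≡ c → bit (lookup S u) * 1 ≡ bit (not (lookup S v)) * 1 →
                (u ∈ S × v ∉ S) ⊎ (u ∉ S × v ∈ S)
        split true  false p q _ = inj₁ (lookup⇒[]= u S p , lookup⇒∉ q)
        split false true  p q _ = inj₂ (lookup⇒∉ p , lookup⇒[]= v S q)
        split true  true  p q r rewrite p | q with () ← r
        split false false p q r rewrite p | q with () ← r

      -- The two volumes add up to twice the number of edges, and that of `S` is the smaller one.
      volume≤edges : volume S ≤ numEdges G
      volume≤edges = *-cancelˡ-≤ 2 (begin
        2 * volume S              ≡⟨ cong (volume S +_) (+-identityʳ _) ⟩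
        volume S + volume S       ≤⟨ +-monoʳ-≤ (volume S) volume≤volume-∁ ⟩
        volume S + volume (∁ S)   ≡⟨ volume-∁ S ⟩
        numEdges G + numEdges G   ≡⟨ cong (numEdges G +_) (+-identityʳ _) ⟨
        2 * numEdges G            ∎)
        where open ≤-Reasoning

      edges≤volume-∁ : numEdges G ≤ volume (∁ S)
      edges≤volume-∁ = +-cancelˡ-≤ (numEdges G) _ _ (begin
        numEdges G + numEdges G     ≡⟨ volume-∁ S ⟨
        volume S + volume (∁ S)     ≤⟨ +-monoˡ-≤ (volume (∁ S)) volume≤edges ⟩
        numEdges G + volume (∁ S)   ∎)
        where open ≤-Reasoning

    bipartition⇒independent : ∀ {S} → IsBipartition G S → Independent G S
    bipartition⇒independent bip u∈S v∈S u~v with bip u~v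
    ... | inj₁ (_ , v∉S) = v∉S v∈S
    ... | inj₂ (u∉S , _) = u∉S u∈S

    -- Consequences for δ, Δ and β, and the extremal graphs.

    module Extremal {δ Δ β : ℕ} (minδ : IsMinDegree G δ) (1≤δ : 1 ≤ δ) (maxΔ : IsMaxDegree G Δ)
                    (indβ : IsIndependenceNumber G β) where

      private
        S = proj₁ (proj₁ indβ)
        indep : Independent G S
        indep = proj₁ (proj₂ (proj₁ indβ))
        ∣S∣≡β = proj₂ (proj₂ (proj₁ indβ))
        e = numEdges G
        instance
          nzδ : NonZero δ
          nzδ = δ≢0 G minδ 1≤δ

      ∣∁S∣≡n∸β : ∣ ∁ S ∣ ≡ n ∸ β
      ∣∁S∣≡n∸β = trans (∣∁p∣≡n∸∣p∣ S) (cong (n ∸_) ∣S∣≡β)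

      βδ≤e : β * δ ≤ e
      βδ≤e = ≤-trans (subst (λ k → k * δ ≤ volume S) ∣S∣≡β (volume-≥ S (proj₂ minδ))) (volume≤edges indep)

      e≤[n∸β]Δ : e ≤ (n ∸ β) * Δ
      e≤[n∸β]Δ = ≤-trans (edges≤volume-∁ indep) (subst (λ k → volume (∁ S) ≤ k * Δ) ∣∁S∣≡n∸β (volume-≤ (∁ S) (proj₂ maxΔ)))

      δ≤Δ : δ ≤ Δ
      δ≤Δ = ≤-trans (proj₂ minδ (proj₁ (proj₁ maxΔ))) (≤-reflexive (proj₂ (proj₁ maxΔ)))

      β+[n∸β]≡n : β + (n ∸ β) ≡ n
      β+[n∸β]≡n = m+[n∸m]≡n (subst (_≤ n) ∣S∣≡β (∣p∣≤n S))

      regular-degree : δ ≡ Δ → ∀ u → degree G u ≡ δ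
      regular-degree refl u = ≤-antisym (proj₂ maxΔ u) (proj₂ minδ u)

      -- In a δ-regular graph the volume of a set is δ times its size. With e = βδ the volume of `S`
      -- is e, hence so is that of its complement: equal volumes give the bipartition, and
      -- cancelling δ gives the balance.
      extremal⇒RBB : δ ≡ Δ → e ≡ β * δ → RegularBalancedBipartite G
      extremal⇒RBB δ≡Δ e≡βδ =
        (δ , regular) , S , tight⇒bipartition indep (trans volS (sym vol∁)) , ∣S∣≡∣∁S∣
        where
        regular = regular-degree δ≡Δ
        vol : ∀ T → volume T ≡ ∣ T ∣ * δ
        vol T = ≤-antisym (volume-≤ T (≤-reflexive ∘ regular)) (volume-≥ T (≤-reflexive ∘ sym ∘ regular))
        volS : volume S ≡ e
        volS = trans (vol S) (trans (cong (_* δ) ∣S∣≡β) (sym e≡βδ))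
        vol∁ : volume (∁ S) ≡ e
        vol∁ = +-cancelˡ-≡ e _ _ (trans (cong (_+ volume (∁ S)) (sym volS)) (volume-∁ S))
        ∣S∣≡∣∁S∣ : ∣ S ∣ ≡ ∣ ∁ S ∣
        ∣S∣≡∣∁S∣ = *-cancelʳ-≡ _ _ δ (trans (sym (vol S)) (trans volS (trans (sym vol∁) (vol (∁ S)))))

      regular⇒δ≡Δ : Regular G → δ ≡ Δ
      regular⇒δ≡Δ (k , reg) = trans (sym (proj₂ (proj₁ minδ))) (trans (reg _) (trans (sym (reg _)) (proj₂ (proj₁ maxΔ))))

      -- The given part `T` need not be the chosen maximum independent set, so its size has to be
      -- identified with β. Halving the degree sum gives e = |T| δ; then βδ ≤ e yields β ≤ |T|,
      -- while independence of `T` yields the converse.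
      RBB⇒extremal : RegularBalancedBipartite G → δ ≡ Δ × e ≡ β * δ × n ∸ β ≡ β
      RBB⇒extremal (regular , T , bip , ∣T∣≡∣∁T∣) =
        δ≡Δ , trans e≡ (cong (_* δ) ∣T∣≡β) , (begin
          n ∸ β       ≡⟨ cong (n ∸_) ∣T∣≡β ⟨
          n ∸ ∣ T ∣   ≡⟨ ∣∁p∣≡n∸∣p∣ T ⟨
          ∣ ∁ T ∣     ≡⟨ ∣T∣≡∣∁T∣ ⟨
          ∣ T ∣       ≡⟨ ∣T∣≡β ⟩
          β           ∎)
        where
        open ≡-Reasoning
        δ≡Δ = regular⇒δ≡Δ regular
        vol : ∀ T → volume T ≡ ∣ T ∣ * δ
        vol T = ≤-antisym (volume-≤ T (≤-reflexive ∘ regular-degree δ≡Δ)) (volume-≥ T (proj₂ minδ))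
        e≡ : e ≡ ∣ T ∣ * δ
        e≡ = *-cancelˡ-≡ _ _ 2 (begin
          2 * e                     ≡⟨ cong (e +_) (+-identityʳ e) ⟩
          e + e                     ≡⟨ volume-∁ T ⟨
          volume T + volume (∁ T)   ≡⟨ cong₂ _+_ (vol T) (trans (vol (∁ T)) (cong (_* δ) (sym ∣T∣≡∣∁T∣))) ⟩
          ∣ T ∣ * δ + ∣ T ∣ * δ     ≡⟨ cong (∣ T ∣ * δ +_) (+-identityʳ _) ⟨
          2 * (∣ T ∣ * δ)           ∎)
        ∣T∣≡β : ∣ T ∣ ≡ β
        ∣T∣≡β = ≤-antisym (proj₂ indβ T (bipartition⇒independent bip))
          (*-cancelʳ-≤ β ∣ T ∣ δ (≤-trans βδ≤e (≤-reflexive e≡)))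

      forgotten-≥ : n * δ ^ 3 ≤ forgotten G
      forgotten-≥ = ≤-trans (≤-reflexive (sym (∑-const n (δ ^ 3)))) (∑-mono-≤ λ u → ^-monoˡ-≤ 3 (proj₂ minδ u))

      -- Equality holds at every vertex, in particular at one of maximum degree, whose cube is then
      -- δ³.
      forgotten-tight : forgotten G ≡ n * δ ^ 3 → δ ≡ Δ
      forgotten-tight eq = trans (sym (cube-injective w³)) (proj₂ (proj₁ maxΔ))
        where
        w = proj₁ (proj₁ maxΔ)
        w³ : δ ^ 3 ≡ degree G w ^ 3
        w³ = ∑-mono-≤-tight (λ u → ^-monoˡ-≤ 3 (proj₂ minδ u)) (trans (∑-const n (δ ^ 3)) (sym eq)) w
        cube-injective : δ ^ 3 ≡ degree G w ^ 3 → degree G w ≡ δ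
        cube-injective eq with <-cmp δ (degree G w)
        ... | tri≈ _ p _ = sym p
        ... | tri< p _ _ = contradiction eq (<⇒≢ (^-monoˡ-< 3 p))
        ... | tri> _ _ p = contradiction (proj₂ minδ w) (<⇒≱ p)

      forgotten-regular : δ ≡ Δ → forgotten G ≡ n * δ ^ 3
      forgotten-regular δ≡Δ = trans (sum-cong-≗ (λ u → cong (_^ 3) (regular-degree δ≡Δ u))) (∑-const n (δ ^ 3))

      -- A squared degree is bounded by Δ² outside `S`, but inside `S` only one factor is replaced
      -- by Δ, so that the remaining factors sum to `volume S`, which is at most e.
      zagreb-≤ : firstZagreb G ≤ (n ∸ β) * Δ ^ 2 + e * Δ
      zagreb-≤ = begin
        firstZagreb G
          ≤⟨ ∑-mono-≤ pointwise ⟩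
        ∑[ u < n ] (bit (not (lookup S u)) * Δ ^ 2 + bit (lookup S u) * degree G u * Δ)
          ≡⟨ ∑-distrib-+ (λ u → bit (not (lookup S u)) * Δ ^ 2) _ ⟩
        ∑[ u < n ] (bit (not (lookup S u)) * Δ ^ 2) + ∑[ u < n ] (bit (lookup S u) * degree G u * Δ)
          ≡⟨ cong₂ _+_ (*-distribʳ-sum (Δ ^ 2) (λ u → bit (not (lookup S u)))) (*-distribʳ-sum Δ (λ u → bit (lookup S u) * degree G u)) ⟨
        ∑[ u < n ] bit (not (lookup S u)) * Δ ^ 2 + volume S * Δ
          ≡⟨ cong (λ k → k * Δ ^ 2 + volume S * Δ) (trans (sym (∣∁S∣≡∑ S)) ∣∁S∣≡n∸β) ⟩
        (n ∸ β) * Δ ^ 2 + volume S * Δ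
          ≤⟨ +-monoʳ-≤ ((n ∸ β) * Δ ^ 2) (*-monoˡ-≤ Δ (volume≤edges indep)) ⟩
        (n ∸ β) * Δ ^ 2 + e * Δ ∎
        where
        open ≤-Reasoning
        pointwise : ∀ u → degree G u ^ 2 ≤ bit (not (lookup S u)) * Δ ^ 2 + bit (lookup S u) * degree G u * Δ
        pointwise u with lookup S u
        ... | true  = ≤-trans (*-monoʳ-≤ (degree G u) (≤-trans (≤-reflexive (*-identityʳ _)) (proj₂ maxΔ u)))
                        (≤-reflexive (cong (_* Δ) (sym (+-identityʳ (degree G u)))))
        ... | false = ≤-trans (^-monoˡ-≤ 2 (proj₂ maxΔ u)) (≤-reflexive (sym (trans (+-identityʳ _) (+-identityʳ _))))

      zagreb-regular : δ ≡ Δ → firstZagreb G ≡ n * Δ ^ 2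
      zagreb-regular δ≡Δ = trans (sum-cong-≗ (λ u → cong (_^ 2) (trans (regular-degree δ≡Δ u) δ≡Δ))) (∑-const n (Δ ^ 2))

-- The embedding of ℕ in ℚ, reciprocals and rational sums.

open import Data.Nat.Properties using (m*n≢0; m^n≢0)
open import Data.Rational.Base using (ℚ; _+_; _-_; _*_; _≤_; -_; _/_; 1ℚ; Positive; NonNegative; toℚᵘ)
open import Data.Rational.Properties
open import Data.Rational.Solver using (module +-*-Solver)
open import Data.Rational.Unnormalised.Base as ℚᵘ using (mkℚᵘ; *≡*; *≤*)
open import Algebra.Properties.CommutativeMonoid.Sum +-0-commutativeMonoid using (sum-cong-≗) renaming (sum to ∑ℚ)
open import Algebra.Properties.Group +-0-group using () renaming (∙-cancelˡ to +-cancelˡ)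
open +-*-Solver using (solve; _:=_; _:+_; _:*_; _:-_)

-- `ι k` is a normalised fraction, which hides its numerator for variable `k`; the unnormalised form
-- shows it. The stored 0 is the denominator minus one.
toℚᵘ-ι : ∀ k → toℚᵘ (ι k) ℚᵘ.≃ mkℚᵘ (ℤ.+ k) 0
toℚᵘ-ι k = toℚᵘ-fromℚᵘ (mkℚᵘ (ℤ.+ k) 0)

ι-+ : ∀ a b → ι (a ℕ.+ b) ≡ ι a + ι b
ι-+ a b = toℚᵘ-injective (begin
  toℚᵘ (ι (a ℕ.+ b))                   ≈⟨ toℚᵘ-ι (a ℕ.+ b) ⟩
  mkℚᵘ (ℤ.+ (a ℕ.+ b)) 0               ≈⟨ *≡* (cong₂ (λ x y → (x ℤ.+ y) ℤ.* ℤ.+ 1) (ℤₚ.*-identityʳ (ℤ.+ a)) (ℤₚ.*-identityʳ (ℤ.+ b))) ⟨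
  mkℚᵘ (ℤ.+ a) 0 ℚᵘ.+ mkℚᵘ (ℤ.+ b) 0   ≈⟨ ℚᵘₚ.+-cong (toℚᵘ-ι a) (toℚᵘ-ι b) ⟨
  toℚᵘ (ι a) ℚᵘ.+ toℚᵘ (ι b)           ≈⟨ toℚᵘ-homo-+ (ι a) (ι b) ⟨
  toℚᵘ (ι a + ι b)                     ∎)
  where open ℚᵘₚ.≃-Reasoning

ι-* : ∀ a b → ι (a ℕ.* b) ≡ ι a * ι b
ι-* a b = toℚᵘ-injective (begin
  toℚᵘ (ι (a ℕ.* b))                   ≈⟨ toℚᵘ-ι (a ℕ.* b) ⟩
  mkℚᵘ (ℤ.+ (a ℕ.* b)) 0               ≈⟨ *≡* (cong (ℤ._* ℤ.+ 1) (ℤₚ.pos-* a b)) ⟩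
  mkℚᵘ (ℤ.+ a) 0 ℚᵘ.* mkℚᵘ (ℤ.+ b) 0   ≈⟨ ℚᵘₚ.*-cong (toℚᵘ-ι a) (toℚᵘ-ι b) ⟨
  toℚᵘ (ι a) ℚᵘ.* toℚᵘ (ι b)           ≈⟨ toℚᵘ-homo-* (ι a) (ι b) ⟨
  toℚᵘ (ι a * ι b)                     ∎)
  where open ℚᵘₚ.≃-Reasoning

ι-mono-≤ : ∀ {a b} → a ℕ.≤ b → ι a ≤ ι b
ι-mono-≤ {a} {b} a≤b = toℚᵘ-cancel-≤ (begin
  toℚᵘ (ι a)       ≃⟨ toℚᵘ-ι a ⟩
  mkℚᵘ (ℤ.+ a) 0   ≤⟨ *≤* (ℤₚ.*-monoʳ-≤-nonNeg (ℤ.+ 1) (ℤ.+≤+ a≤b)) ⟩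
  mkℚᵘ (ℤ.+ b) 0   ≃⟨ toℚᵘ-ι b ⟨
  toℚᵘ (ι b)       ∎)
  where open ℚᵘₚ.≤-Reasoning

ι-injective : ∀ {a b} → ι a ≡ ι b → a ≡ b
ι-injective {a} {b} eq with fromℚᵘ-injective {mkℚᵘ (ℤ.+ a) 0} {mkℚᵘ (ℤ.+ b) 0} eq
... | *≡* p = ℤₚ.+-injective (ℤₚ.*-cancelʳ-≡ (ℤ.+ a) (ℤ.+ b) (ℤ.+ 1) p)

1/-pos : ∀ d .{{_ : NonZero d}} → Positive (ℤ.+ 1 / d)
1/-pos d = normalize-pos 1 d

ι-pos : ∀ d .{{_ : NonZero d}} → Positive (ι d)
ι-pos d = normalize-pos d 1

1/-inverse : ∀ d .{{_ : NonZero d}} → (ℤ.+ 1 / d) * ι d ≡ 1ℚ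
1/-inverse d@(suc d-1) = toℚᵘ-injective (begin
  toℚᵘ ((ℤ.+ 1 / d) * ι d)               ≈⟨ toℚᵘ-homo-* (ℤ.+ 1 / d) (ι d) ⟩
  toℚᵘ (ℤ.+ 1 / d) ℚᵘ.* toℚᵘ (ι d)       ≈⟨ ℚᵘₚ.*-cong (toℚᵘ-fromℚᵘ (mkℚᵘ (ℤ.+ 1) d-1)) (toℚᵘ-ι d) ⟩
  mkℚᵘ (ℤ.+ 1) d-1 ℚᵘ.* mkℚᵘ (ℤ.+ d) 0   ≈⟨ *≡* (trans (ℤₚ.*-identityʳ (ℤ.+ 1 ℤ.* ℤ.+ d)) (sym (cong (λ x → ℤ.+ 1 ℤ.* ℤ.+ x) (ℕₚ.*-identityʳ d)))) ⟩
  toℚᵘ 1ℚ                                ∎)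
  where open ℚᵘₚ.≃-Reasoning

÷ℕ-inverse : ∀ p d .{{_ : NonZero d}} → p ÷ℕ d * ι d ≡ p
÷ℕ-inverse p d = trans (*-assoc p (ℤ.+ 1 / d) (ι d)) (trans (cong (p *_) (1/-inverse d)) (*-identityʳ p))

*-cancelʳ-≡-pos : ∀ {p q} r → Positive r → p * r ≡ q * r → p ≡ q
*-cancelʳ-≡-pos r pos eq = ≤-antisym
  (*-cancelʳ-≤-pos r {{pos}} (≤-reflexive eq)) (*-cancelʳ-≤-pos r {{pos}} (≤-reflexive (sym eq)))

-- Multiplying by both denominators leaves `d ≤ d′`.
1/-antimono-≤ : ∀ {d d′} .{{_ : NonZero d}} .{{_ : NonZero d′}} → d ℕ.≤ d′ → ℤ.+ 1 / d′ ≤ ℤ.+ 1 / d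
1/-antimono-≤ {d} {d′} d≤d′ =
  *-cancelʳ-≤-pos (ι d) {{ι-pos d}} (*-cancelʳ-≤-pos (ι d′) {{ι-pos d′}} (begin
    (ℤ.+ 1 / d′) * ι d * ι d′   ≡⟨ solve 3 (λ x y z → x :* y :* z := x :* z :* y) refl (ℤ.+ 1 / d′) (ι d) (ι d′) ⟩
    (ℤ.+ 1 / d′) * ι d′ * ι d   ≡⟨ cong (_* ι d) (1/-inverse d′) ⟩
    1ℚ * ι d                    ≡⟨ *-identityˡ (ι d) ⟩
    ι d                         ≤⟨ ι-mono-≤ d≤d′ ⟩
    ι d′                        ≡⟨ *-identityˡ (ι d′) ⟨
    1ℚ * ι d′                   ≡⟨ cong (_* ι d′) (1/-inverse d) ⟨
    (ℤ.+ 1 / d) * ι d * ι d′    ∎))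
  where open ≤-Reasoning

∑ℚ-mono-≤ : ∀ {n} {f g : Fin n → ℚ} → (∀ i → f i ≤ g i) → ∑ℚ f ≤ ∑ℚ g
∑ℚ-mono-≤ {zero}  f≤g = ≤-refl
∑ℚ-mono-≤ {suc n} f≤g = +-mono-≤ (f≤g zero) (∑ℚ-mono-≤ (f≤g ∘ suc))

∑ℚ-const : ∀ n c → ∑ℚ {n} (λ _ → c) ≡ ι n * c
∑ℚ-const zero    c = sym (*-zeroˡ c)
∑ℚ-const (suc n) c = begin
  c + ∑ℚ {n} (λ _ → c)   ≡⟨ cong₂ _+_ (sym (*-identityˡ c)) (∑ℚ-const n c) ⟩
  1ℚ * c + ι n * c       ≡⟨ *-distribʳ-+ c 1ℚ (ι n) ⟨
  (1ℚ + ι n) * c         ≡⟨ cong (_* c) (ι-+ 1 n) ⟨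
  ι (suc n) * c          ∎
  where open ≡-Reasoning

-- All four lower bounds have this shape, with x one of the brackets A and B of the statement.
affine-bound : ∀ {R : Set} (c k x α : ℚ) {F : ℚ} → Positive k → x ≤ α → c + k * α ≤ F →
               (x ≡ α → F ≡ c + k * α → R) → (R → x ≡ α × F ≡ c + k * α) →
               (c + k * x ≤ F) × (F ≡ c + k * x ⇔ R)
affine-bound {R} c k x α {F} k>0 x≤α ckα≤F to from = ckx≤F , mk⇔ fwd bwd
  where
  ckx≤ckα : c + k * x ≤ c + k * α
  ckx≤ckα = +-monoʳ-≤ c (*-monoˡ-≤-nonNeg k {{pos⇒nonNeg k {{k>0}}}} x≤α)
  ckx≤F : c + k * x ≤ F
  ckx≤F = ≤-trans ckx≤ckα ckα≤F
  fwd : F ≡ c + k * x → R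
  fwd eq = to x≡α F≡
    where
    -- `F` equals the bound at `x`, which is at most the bound at `α`, which is at most `F`; so all
    -- three coincide.
    F≡ : F ≡ c + k * α
    F≡ = ≤-antisym (≤-trans (≤-reflexive eq) ckx≤ckα) ckα≤F
    x≡α : x ≡ α
    x≡α = *-cancelʳ-≡-pos k k>0 (trans (*-comm x k)
      (trans (+-cancelˡ c (k * x) (k * α) (trans (sym eq) F≡)) (*-comm k α)))
  bwd : R → F ≡ c + k * x
  bwd r with from r
  ... | refl , F≡ = F≡

-- AM-GM in ℕ and the Zagreb bound with denominators cleared.

square-injective : ∀ {x y} → x ^ 2 ≡ y ^ 2 → x ≡ y
square-injective {x} {y} eq with ℕₚ.<-cmp x y
... | tri< p _ _ = contradiction eq (ℕₚ.<⇒≢ (ℕₚ.^-monoˡ-< 2 p))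
... | tri≈ _ p _ = p
... | tri> _ _ p = contradiction (sym eq) (ℕₚ.<⇒≢ (ℕₚ.^-monoˡ-< 2 p))

-- Powers are written out because solve-∀ treats _^_ on ℕ as opaque.
am-gm-expand : ∀ x k → x *ℕ (x *ℕ 1) +ℕ (x +ℕ k) *ℕ ((x +ℕ k) *ℕ 1) ≡ 2 *ℕ (x *ℕ (x +ℕ k)) +ℕ k *ℕ k
am-gm-expand = solve-∀

-- Writing `y` as `x + k` avoids subtraction: the gap between the two sides is k², which vanishes
-- only for k = 0.
am-gm-≤ : ∀ {x y} → x ≤ℕ y → 2 *ℕ (x *ℕ y) ≤ℕ x ^ 2 +ℕ y ^ 2 × (2 *ℕ (x *ℕ y) ≡ x ^ 2 +ℕ y ^ 2 → x ≡ y)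
am-gm-≤ {x} {y} x≤y with ℕₚ.m≤n⇒∃[o]m+o≡n x≤y
... | k , refl = ℕₚ.≤-trans (ℕₚ.m≤m+n _ (k *ℕ k)) (ℕₚ.≤-reflexive (sym (am-gm-expand x k))) , tight-case
  where
  tight-case : 2 *ℕ (x *ℕ (x +ℕ k)) ≡ x ^ 2 +ℕ (x +ℕ k) ^ 2 → x ≡ x +ℕ k
  tight-case eq = trans (sym (ℕₚ.+-identityʳ x)) (cong (x +ℕ_) (sym k≡0))
    where
    k²≡0 : k *ℕ k ≡ 0
    k²≡0 = ℕₚ.+-cancelˡ-≡ _ (k *ℕ k) 0 (trans (sym (am-gm-expand x k)) (trans (sym eq) (sym (ℕₚ.+-identityʳ _))))
    k≡0 : k ≡ 0
    k≡0 with ℕₚ.m*n≡0⇒m≡0∨n≡0 k k²≡0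
    ... | inj₁ p = p
    ... | inj₂ p = p

am-gm : ∀ x y → 2 *ℕ (x *ℕ y) ≤ℕ x ^ 2 +ℕ y ^ 2 × (2 *ℕ (x *ℕ y) ≡ x ^ 2 +ℕ y ^ 2 → x ≡ y)
am-gm x y with ℕₚ.≤-total x y
... | inj₁ x≤y = am-gm-≤ x≤y
... | inj₂ y≤x rewrite ℕₚ.*-comm x y | ℕₚ.+-comm (x ^ 2) (y ^ 2) with am-gm-≤ y≤x
...   | le , eq = le , λ p → sym (eq p)

module _ (δ Δ β e : ℕ) .{{_ : NonZero β}} .{{_ : NonZero Δ}} (δ≤Δ : δ ≤ℕ Δ) where

  private
    y = β *ℕ Δ
    -- `lhs` and `rhs` are eΔ and e²/2β + βΔ³/2δ multiplied by 4βδ. AM-GM for e and βΔ leads from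
    -- `lhs` to `mid`, and replacing one δ by Δ leads from `mid` to `rhs`.
    lhs mid rhs : ℕ
    lhs = 2 *ℕ δ *ℕ (2 *ℕ (e *ℕ y))
    mid = 2 *ℕ δ *ℕ (e ^ 2 +ℕ y ^ 2)
    rhs = 2 *ℕ δ *ℕ e ^ 2 +ℕ 2 *ℕ Δ *ℕ y ^ 2

    mid≡ : mid ≡ 2 *ℕ δ *ℕ e ^ 2 +ℕ 2 *ℕ δ *ℕ y ^ 2
    mid≡ = ℕₚ.*-distribˡ-+ (2 *ℕ δ) (e ^ 2) (y ^ 2)

    lhs≤mid : lhs ≤ℕ mid
    lhs≤mid = ℕₚ.*-monoʳ-≤ (2 *ℕ δ) (proj₁ (am-gm e y))

    mid≤rhs : mid ≤ℕ rhs
    mid≤rhs = ℕₚ.≤-trans (ℕₚ.≤-reflexive mid≡)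
      (ℕₚ.+-monoʳ-≤ (2 *ℕ δ *ℕ e ^ 2) (ℕₚ.*-monoˡ-≤ (y ^ 2) (ℕₚ.*-monoʳ-≤ 2 δ≤Δ)))

  edge-term-≤ : lhs ≤ℕ rhs
  edge-term-≤ = ℕₚ.≤-trans lhs≤mid mid≤rhs

  -- Both links of the chain through `mid` become equalities: the second gives δ = Δ because `y ^ 2`
  -- is nonzero, the first is the equality case of AM-GM.
  edge-term-tight : .{{_ : NonZero δ}} → lhs ≡ rhs → δ ≡ Δ × e ≡ β *ℕ Δ
  edge-term-tight eq = δ≡Δ , e≡βΔ
    where
    instance
      y≢0 : NonZero y
      y≢0 = ℕₚ.m*n≢0 β Δ
      y²≢0 : NonZero (y ^ 2)
      y²≢0 = ℕₚ.m^n≢0 y 2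
      2δ≢0 : NonZero (2 *ℕ δ)
      2δ≢0 = ℕₚ.m*n≢0 2 δ
    mid≡rhs : mid ≡ rhs
    mid≡rhs = ℕₚ.≤-antisym mid≤rhs (ℕₚ.≤-trans (ℕₚ.≤-reflexive (sym eq)) lhs≤mid)
    δ≡Δ : δ ≡ Δ
    δ≡Δ = ℕₚ.*-cancelˡ-≡ δ Δ 2 (ℕₚ.*-cancelʳ-≡ _ _ (y ^ 2)
      (ℕₚ.+-cancelˡ-≡ (2 *ℕ δ *ℕ e ^ 2) _ _ (trans (sym mid≡) mid≡rhs)))
    e≡βΔ : e ≡ y
    e≡βΔ = proj₂ (am-gm e y) (ℕₚ.*-cancelˡ-≡ _ _ (2 *ℕ δ) (trans eq (sym mid≡rhs)))

-- Over the common denominator 4βδ the Zagreb bound has a natural numerator, so the comparison can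
-- be carried out in ℕ. Here `D`, `e` and `D′` stand for Δ², e² and Δ³.
bound₁-scaled : ∀ m D e D′ β δ .{{_ : NonZero (2 *ℕ β)}} .{{_ : NonZero (2 *ℕ δ)}} →
  (ι m * ι D + ι e ÷ℕ (2 *ℕ β) + (ι β * ι D′) ÷ℕ (2 *ℕ δ)) * ι (2 *ℕ β *ℕ (2 *ℕ δ)) ≡
  ι (m *ℕ D *ℕ (2 *ℕ β *ℕ (2 *ℕ δ)) +ℕ (e *ℕ (2 *ℕ δ) +ℕ β *ℕ D′ *ℕ (2 *ℕ β)))
bound₁-scaled m D e D′ β δ = begin
  (P + E ÷ℕ b + W ÷ℕ d) * ι (b *ℕ d)
    ≡⟨ cong ((P + E ÷ℕ b + W ÷ℕ d) *_) (ι-* b d) ⟩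
  (P + E ÷ℕ b + W ÷ℕ d) * (ι b * ι d)
    ≡⟨ solve 5 (λ p x y b d → (p :+ x :+ y) :* (b :* d) := p :* (b :* d) :+ (x :* b :* d :+ y :* d :* b)) refl P (E ÷ℕ b) (W ÷ℕ d) (ι b) (ι d) ⟩
  P * (ι b * ι d) + (E ÷ℕ b * ι b * ι d + W ÷ℕ d * ι d * ι b)
    ≡⟨ cong₂ (λ x y → P * (ι b * ι d) + (x * ι d + y * ι b)) (÷ℕ-inverse E b) (÷ℕ-inverse W d) ⟩
  P * (ι b * ι d) + (E * ι d + W * ι b)
    ≡⟨ cong₂ _+_ (cong₂ _*_ (ι-* m D) (ι-* b d)) (cong₂ _+_ (ι-* e d) (cong (_* ι b) (ι-* β D′))) ⟨
  ι (m *ℕ D) * ι (b *ℕ d) + (ι (e *ℕ d) + ι (β *ℕ D′) * ι b)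
    ≡⟨ cong₂ (λ x y → x + (ι (e *ℕ d) + y)) (ι-* (m *ℕ D) (b *ℕ d)) (ι-* (β *ℕ D′) b) ⟨
  ι (m *ℕ D *ℕ (b *ℕ d)) + (ι (e *ℕ d) + ι (β *ℕ D′ *ℕ b))
    ≡⟨ cong (ι (m *ℕ D *ℕ (b *ℕ d)) +_) (ι-+ (e *ℕ d) _) ⟨
  ι (m *ℕ D *ℕ (b *ℕ d)) + ι (e *ℕ d +ℕ β *ℕ D′ *ℕ b)
    ≡⟨ ι-+ (m *ℕ D *ℕ (b *ℕ d)) _ ⟨
  ι (m *ℕ D *ℕ (b *ℕ d) +ℕ (e *ℕ d +ℕ β *ℕ D′ *ℕ b)) ∎
  where
  open ≡-Reasoning
  b = 2 *ℕ β
  d = 2 *ℕ δ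
  P = ι m * ι D
  E = ι e
  W = ι β * ι D′

scaled-≤ : ∀ Z {q N x} .{{_ : NonZero q}} → x * ι q ≡ ι N → Z *ℕ q ≤ℕ N → ι Z ≤ x
scaled-≤ Z {q} {N} {x} eq Zq≤N = *-cancelʳ-≤-pos (ι q) {{ι-pos q}} (begin
  ι Z * ι q    ≡⟨ ι-* Z q ⟨
  ι (Z *ℕ q)   ≤⟨ ι-mono-≤ Zq≤N ⟩
  ι N          ≡⟨ eq ⟨
  x * ι q      ∎)
  where open ≤-Reasoning

scaled-≡ : ∀ Z {q N x} .{{_ : NonZero q}} → x * ι q ≡ ι N → ι Z ≡ x ⇔ Z *ℕ q ≡ N
scaled-≡ Z {q} {N} {x} eq = mk⇔
  (λ p → ι-injective (trans (ι-* Z q) (trans (cong (_* ι q) p) eq)))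
  (λ p → *-cancelʳ-≡-pos (ι q) (ι-pos q) (trans (sym (ι-* Z q)) (trans (cong ι p) (sym eq))))

-- The brackets of the four lower bounds, and the bounds at the largest bracket.

p+p-q≤p : ∀ {p q} → p ≤ q → p + p - q ≤ p
p+p-q≤p {p} {q} p≤q = begin
  p + p - q   ≤⟨ +-monoˡ-≤ (- q) (+-monoʳ-≤ p p≤q) ⟩
  p + q - q   ≡⟨ solve 2 (λ p q → p :+ q :- q := p) refl p q ⟩
  p           ∎
  where open ≤-Reasoning

p+p-q≡p⇒q≡p : ∀ {p q} → p + p - q ≡ p → q ≡ p
p+p-q≡p⇒q≡p {p} {q} eq = begin
  q                     ≡⟨ solve 2 (λ p q → q := p :+ p :- (p :+ p :- q)) refl p q ⟩
  p + p - (p + p - q)   ≡⟨ cong (λ x → p + p - x) eq ⟩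
  p + p - p             ≡⟨ solve 1 (λ p → p :+ p :- p := p) refl p ⟩
  p                     ∎
  where open ≡-Reasoning

module _ (β δ e : ℕ) where

  -- `α` is the value of the bracket `A` at e = βδ. In general `A` is `p + p - q` with `p` = (βδ)²
  -- and `q` = e², so it stays below `α` as long as βδ ≤ e.
  A α : ℚ
  A = ι 2 * ι (β ^ 2) * ι (δ ^ 2) - ι (e ^ 2)
  α = ι ((β *ℕ δ) ^ 2)

  A-expand : A ≡ α + α - ι (e ^ 2)
  A-expand = cong (_- ι (e ^ 2)) (begin
    ι 2 * ι (β ^ 2) * ι (δ ^ 2)        ≡⟨ cong (_* ι (δ ^ 2)) (ι-* 2 (β ^ 2)) ⟨
    ι (2 *ℕ β ^ 2) * ι (δ ^ 2)         ≡⟨ ι-* (2 *ℕ β ^ 2) (δ ^ 2) ⟨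
    ι (2 *ℕ β ^ 2 *ℕ δ ^ 2)            ≡⟨ cong ι (nat β δ) ⟩
    ι ((β *ℕ δ) ^ 2 +ℕ (β *ℕ δ) ^ 2)   ≡⟨ ι-+ ((β *ℕ δ) ^ 2) ((β *ℕ δ) ^ 2) ⟩
    α + α                              ∎)
    where
    open ≡-Reasoning
    nat : ∀ b d → 2 *ℕ (b *ℕ (b *ℕ 1)) *ℕ (d *ℕ (d *ℕ 1)) ≡ (b *ℕ d) *ℕ ((b *ℕ d) *ℕ 1) +ℕ (b *ℕ d) *ℕ ((b *ℕ d) *ℕ 1)
    nat = solve-∀

  A≤α : β *ℕ δ ≤ℕ e → A ≤ α
  A≤α βδ≤e = ≤-trans (≤-reflexive A-expand) (p+p-q≤p (ι-mono-≤ (ℕₚ.^-monoˡ-≤ 2 βδ≤e)))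

  A≡α⇒e≡βδ : A ≡ α → e ≡ β *ℕ δ
  A≡α⇒e≡βδ eq = square-injective (ι-injective (p+p-q≡p⇒q≡p (trans (sym A-expand) eq)))

  e≡βδ⇒A≡α : e ≡ β *ℕ δ → A ≡ α
  e≡βδ⇒A≡α refl = trans A-expand (solve 1 (λ p → p :+ p :- p := p) refl α)

  module _ (m Δ : ℕ) .{{_ : NonZero m}} where

    B : ℚ
    B = ι 2 * ι β * (ι β * ι (δ ^ 2) + ι (e ^ 2) ÷ℕ m) - ι (e ^ 2) - ι 2 * ι β * ι m * ι (Δ ^ 2)

    private
      ββ≡β² : ι β * ι β ≡ ι (β ^ 2)
      ββ≡β² = trans (sym (ι-* β β)) (cong (λ x → ι (β *ℕ x)) (sym (ℕₚ.*-identityʳ β)))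

      Y : ℚ
      Y = ι m * ι (Δ ^ 2)

      -- Multiplication by m turns the comparison of e²/m with mΔ² into one of the squares of e and
      -- mΔ.
      Y-scaled : Y * ι m ≡ ι ((m *ℕ Δ) ^ 2)
      Y-scaled = trans (cong (_* ι m) (sym (ι-* m (Δ ^ 2)))) (trans (sym (ι-* (m *ℕ Δ ^ 2) m)) (cong ι (nat m Δ)))
        where
        nat : ∀ m D → m *ℕ (D *ℕ (D *ℕ 1)) *ℕ m ≡ m *ℕ D *ℕ (m *ℕ D *ℕ 1)
        nat = solve-∀

    -- Isolates the difference of the two brackets, 2β(e²/m - mΔ²), which is nonpositive if e ≤ mΔ
    -- and zero if e = mΔ.
    B-expand : B ≡ A + ι 2 * ι β * (ι (e ^ 2) ÷ℕ m - Y)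
    B-expand = begin
      B
        ≡⟨ solve 7 (λ t b d x e m D → t :* b :* (b :* d :+ x) :- e :- t :* b :* m :* D :=
                     t :* (b :* b) :* d :- e :+ t :* b :* (x :- m :* D)) refl
             (ι 2) (ι β) (ι (δ ^ 2)) (ι (e ^ 2) ÷ℕ m) (ι (e ^ 2)) (ι m) (ι (Δ ^ 2)) ⟩
      ι 2 * (ι β * ι β) * ι (δ ^ 2) - ι (e ^ 2) + ι 2 * ι β * (ι (e ^ 2) ÷ℕ m - Y)
        ≡⟨ cong (λ x → ι 2 * x * ι (δ ^ 2) - ι (e ^ 2) + ι 2 * ι β * (ι (e ^ 2) ÷ℕ m - Y)) ββ≡β² ⟩
      A + ι 2 * ι β * (ι (e ^ 2) ÷ℕ m - Y) ∎
      where open ≡-Reasoning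

    B≤A : e ≤ℕ m *ℕ Δ → B ≤ A
    B≤A e≤mΔ = begin
      B                                      ≡⟨ B-expand ⟩
      A + ι 2 * ι β * (ι (e ^ 2) ÷ℕ m - Y)   ≤⟨ +-monoʳ-≤ A (*-monoˡ-≤-nonNeg (ι 2 * ι β) {{2β-nonNeg}} (+-monoˡ-≤ (- Y) x≤Y)) ⟩
      A + ι 2 * ι β * (Y - Y)                ≡⟨ solve 3 (λ a t y → a :+ t :* (y :- y) := a) refl A (ι 2 * ι β) Y ⟩
      A                                      ∎
      where
      open ≤-Reasoning
      2β-nonNeg : NonNegative (ι 2 * ι β)
      2β-nonNeg = subst NonNegative (ι-* 2 β) (normalize-nonNeg (2 *ℕ β) 1)
      x≤Y : ι (e ^ 2) ÷ℕ m ≤ Y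
      x≤Y = *-cancelʳ-≤-pos (ι m) {{ι-pos m}} (begin
        ι (e ^ 2) ÷ℕ m * ι m   ≡⟨ ÷ℕ-inverse (ι (e ^ 2)) m ⟩
        ι (e ^ 2)              ≤⟨ ι-mono-≤ (ℕₚ.^-monoˡ-≤ 2 e≤mΔ) ⟩
        ι ((m *ℕ Δ) ^ 2)       ≡⟨ Y-scaled ⟨
        Y * ι m                ∎)

    e≡mΔ⇒B≡A : e ≡ m *ℕ Δ → B ≡ A
    e≡mΔ⇒B≡A e≡mΔ = begin
      B                                      ≡⟨ B-expand ⟩
      A + ι 2 * ι β * (ι (e ^ 2) ÷ℕ m - Y)   ≡⟨ cong (λ x → A + ι 2 * ι β * (x - Y)) x≡Y ⟩
      A + ι 2 * ι β * (Y - Y)                ≡⟨ solve 3 (λ a t y → a :+ t :* (y :- y) := a) refl A (ι 2 * ι β) Y ⟩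
      A                                      ∎
      where
      open ≡-Reasoning
      x≡Y : ι (e ^ 2) ÷ℕ m ≡ Y
      x≡Y = *-cancelʳ-≡-pos (ι m) (ι-pos m)
        (trans (÷ℕ-inverse (ι (e ^ 2)) m) (trans (cong (λ x → ι (x ^ 2)) e≡mΔ) (sym Y-scaled)))

-- The second term is (δ/β)(βδ)² = βδ³, as if β further vertices had degree δ. With m = n - β the
-- total is nδ³.
forgotten-affine : ∀ m β δ .{{_ : NonZero β}} →
  ι m * ι (δ ^ 3) + (ι δ ÷ℕ β) * ι ((β *ℕ δ) ^ 2) ≡ ι ((β +ℕ m) *ℕ δ ^ 3)
forgotten-affine m β δ = *-cancelʳ-≡-pos (ι β) (ι-pos β) (begin
  (ι m * ι (δ ^ 3) + (ι δ ÷ℕ β) * ι ((β *ℕ δ) ^ 2)) * ι β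
    ≡⟨ solve 4 (λ c k a b → (c :+ k :* a) :* b := c :* b :+ k :* b :* a) refl (ι m * ι (δ ^ 3)) (ι δ ÷ℕ β) (ι ((β *ℕ δ) ^ 2)) (ι β) ⟩
  ι m * ι (δ ^ 3) * ι β + ι δ ÷ℕ β * ι β * ι ((β *ℕ δ) ^ 2)
    ≡⟨ cong₂ (λ x y → x * ι β + y * ι ((β *ℕ δ) ^ 2)) (sym (ι-* m (δ ^ 3))) (÷ℕ-inverse (ι δ) β) ⟩
  ι (m *ℕ δ ^ 3) * ι β + ι δ * ι ((β *ℕ δ) ^ 2)
    ≡⟨ cong₂ _+_ (ι-* (m *ℕ δ ^ 3) β) (ι-* δ ((β *ℕ δ) ^ 2)) ⟨
  ι (m *ℕ δ ^ 3 *ℕ β) + ι (δ *ℕ (β *ℕ δ) ^ 2)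
    ≡⟨ ι-+ (m *ℕ δ ^ 3 *ℕ β) _ ⟨
  ι (m *ℕ δ ^ 3 *ℕ β +ℕ δ *ℕ (β *ℕ δ) ^ 2)
    ≡⟨ cong ι (nat m β δ) ⟩
  ι ((β +ℕ m) *ℕ δ ^ 3 *ℕ β)
    ≡⟨ ι-* ((β +ℕ m) *ℕ δ ^ 3) β ⟩
  ι ((β +ℕ m) *ℕ δ ^ 3) * ι β ∎)
  where
  open ≡-Reasoning
  nat : ∀ m b d → m *ℕ (d *ℕ (d *ℕ (d *ℕ 1))) *ℕ b +ℕ d *ℕ (b *ℕ d *ℕ (b *ℕ d *ℕ 1)) ≡ (b +ℕ m) *ℕ (d *ℕ (d *ℕ (d *ℕ 1))) *ℕ b
  nat = solve-∀

-- The second term is (βΔ)²/(βΔ³) = β/Δ, so for m = n - β the total is n/Δ.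
inverse-affine : ∀ m β Δ .{{_ : NonZero Δ}} .{{_ : NonZero (β *ℕ Δ ^ 3)}} →
  ι m ÷ℕ Δ + (ι 1 ÷ℕ (β *ℕ Δ ^ 3)) * ι ((β *ℕ Δ) ^ 2) ≡ ι (β +ℕ m) ÷ℕ Δ
inverse-affine m β Δ = begin
  ι m ÷ℕ Δ + k * ι ((β *ℕ Δ) ^ 2)   ≡⟨ cong (ι m ÷ℕ Δ +_) kα≡ ⟩
  ι m ÷ℕ Δ + ι β ÷ℕ Δ               ≡⟨ solve 3 (λ m b i → m :* i :+ b :* i := (b :+ m) :* i) refl (ι m) (ι β) (ℤ.+ 1 / Δ) ⟩
  (ι β + ι m) ÷ℕ Δ                  ≡⟨ cong (_÷ℕ Δ) (ι-+ β m) ⟨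
  ι (β +ℕ m) ÷ℕ Δ                   ∎
  where
  open ≡-Reasoning
  q = β *ℕ Δ ^ 3
  k = ι 1 ÷ℕ q
  nat : ∀ b D → b *ℕ (D *ℕ (D *ℕ (D *ℕ 1))) *ℕ b ≡ b *ℕ D *ℕ (b *ℕ D *ℕ 1) *ℕ D
  nat = solve-∀
  kα≡ : k * ι ((β *ℕ Δ) ^ 2) ≡ ι β ÷ℕ Δ
  kα≡ = *-cancelʳ-≡-pos (ι Δ) (ι-pos Δ) (begin
    k * ι ((β *ℕ Δ) ^ 2) * ι Δ     ≡⟨ *-assoc k (ι ((β *ℕ Δ) ^ 2)) (ι Δ) ⟩
    k * (ι ((β *ℕ Δ) ^ 2) * ι Δ)   ≡⟨ cong (k *_) (ι-* ((β *ℕ Δ) ^ 2) Δ) ⟨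
    k * ι ((β *ℕ Δ) ^ 2 *ℕ Δ)      ≡⟨ cong (λ x → k * ι x) (nat β Δ) ⟨
    k * ι (q *ℕ β)                 ≡⟨ cong (k *_) (ι-* q β) ⟩
    k * (ι q * ι β)                ≡⟨ *-assoc k (ι q) (ι β) ⟨
    k * ι q * ι β                  ≡⟨ cong (_* ι β) (÷ℕ-inverse (ι 1) q) ⟩
    ι 1 * ι β                      ≡⟨ *-identityˡ (ι β) ⟩
    ι β                            ≡⟨ ÷ℕ-inverse (ι β) Δ ⟨
    ι β ÷ℕ Δ * ι Δ                 ∎)

-- The five bounds and their equality cases.

module Bounds {n : ℕ} (G : SimpleGraph n) {δ Δ β : ℕ}
              (minδ : IsMinDegree G δ) (1≤δ : 1 ≤ℕ δ) (maxΔ : IsMaxDegree G Δ)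
              (indβ : IsIndependenceNumber G β) where

  open DegreeCounting.Extremal G minδ 1≤δ maxΔ indβ

  private
    e = numEdges G
    m = n ∸ β
    R = RegularBalancedBipartite G
    instance
      nzδ : NonZero δ
      nzδ = δ≢0 G minδ 1≤δ
      nzΔ : NonZero Δ
      nzΔ = Δ≢0 G minδ 1≤δ maxΔ
      nzβ : NonZero β
      nzβ = β≢0 G minδ 1≤δ indβ
      nzm : NonZero (n ∸ β)
      nzm = n∸β≢0 G minδ 1≤δ indβ
      nz2β : NonZero (2 *ℕ β)
      nz2β = m*n≢0 2 β
      nz2δ : NonZero (2 *ℕ δ)
      nz2δ = m*n≢0 2 δ
      nzq : NonZero (2 *ℕ β *ℕ (2 *ℕ δ))
      nzq = m*n≢0 (2 *ℕ β) (2 *ℕ δ)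
      nzΔ³ : NonZero (Δ ^ 3)
      nzΔ³ = m^n≢0 Δ 3
      nzβΔ³ : NonZero (β *ℕ Δ ^ 3)
      nzβΔ³ = m*n≢0 β (Δ ^ 3)

    -- The bracket values at which the lower bounds collapse: `α₂` gives nδ³ for the forgotten
    -- index, `α₄` gives n/Δ for the inverse degree.
    α₂ α₄ : ℚ
    α₂ = ι ((β *ℕ δ) ^ 2)
    α₄ = ι ((β *ℕ Δ) ^ 2)

    𝒜 ℬ : ℚ
    𝒜 = A β δ e
    ℬ = B β δ e m Δ

    A≤α₂ : 𝒜 ≤ α₂
    A≤α₂ = A≤α β δ e βδ≤e

    α₂≤α₄ : α₂ ≤ α₄
    α₂≤α₄ = ι-mono-≤ (ℕₚ.^-monoˡ-≤ 2 (ℕₚ.*-monoʳ-≤ β δ≤Δ))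

    ℬ≤𝒜 : ℬ ≤ 𝒜
    ℬ≤𝒜 = B≤A β δ e m Δ e≤[n∸β]Δ

    R⇒A≡α₂ : R → 𝒜 ≡ α₂
    R⇒A≡α₂ r = e≡βδ⇒A≡α β δ e (proj₁ (proj₂ (RBB⇒extremal r)))

    R⇒α₂≡α₄ : R → α₂ ≡ α₄
    R⇒α₂≡α₄ r = cong (λ d → ι ((β *ℕ d) ^ 2)) (proj₁ (RBB⇒extremal r))

    R⇒B≡A : R → ℬ ≡ 𝒜
    R⇒B≡A r with RBB⇒extremal r
    ... | δ≡Δ , e≡βδ , m≡β = e≡mΔ⇒B≡A β δ e m Δ (trans e≡βδ (cong₂ _*ℕ_ (sym m≡β) δ≡Δ))

  zagreb-bound : let bound = ι m * ι (Δ ^ 2) + ι (e ^ 2) ÷ℕ (2 *ℕ β) + (ι β * ι (Δ ^ 3)) ÷ℕ (2 *ℕ δ) in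
    ι (firstZagreb G) ≤ bound × (ι (firstZagreb G) ≡ bound ⇔ R)
  zagreb-bound = scaled-≤ Z scale Zq≤N ,
    mk⇔ (λ eq → fwd (Equivalence.to (scaled-≡ Z scale) eq)) (λ r → Equivalence.from (scaled-≡ Z scale) (bwd r))
    where
    Z = firstZagreb G
    q = 2 *ℕ β *ℕ (2 *ℕ δ)
    lhs = 2 *ℕ δ *ℕ (2 *ℕ (e *ℕ (β *ℕ Δ)))
    rhs = 2 *ℕ δ *ℕ e ^ 2 +ℕ 2 *ℕ Δ *ℕ (β *ℕ Δ) ^ 2
    rhs′ = e ^ 2 *ℕ (2 *ℕ δ) +ℕ β *ℕ Δ ^ 3 *ℕ (2 *ℕ β)
    N = m *ℕ Δ ^ 2 *ℕ q +ℕ rhs′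
    scale = bound₁-scaled m (Δ ^ 2) (e ^ 2) (Δ ^ 3) β δ

    lhs≡ : ∀ e b d D → 2 *ℕ d *ℕ (2 *ℕ (e *ℕ (b *ℕ D))) ≡ e *ℕ D *ℕ (2 *ℕ b *ℕ (2 *ℕ d))
    lhs≡ = solve-∀

    rhs≡ : ∀ x b d D → 2 *ℕ d *ℕ x +ℕ 2 *ℕ D *ℕ (b *ℕ D *ℕ (b *ℕ D *ℕ 1)) ≡
                       x *ℕ (2 *ℕ d) +ℕ b *ℕ (D *ℕ (D *ℕ (D *ℕ 1))) *ℕ (2 *ℕ b)
    rhs≡ = solve-∀

    Zq≤ : Z *ℕ q ≤ℕ m *ℕ Δ ^ 2 *ℕ q +ℕ lhs
    Zq≤ = begin
      Z *ℕ q                           ≤⟨ ℕₚ.*-monoˡ-≤ q zagreb-≤ ⟩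
      (m *ℕ Δ ^ 2 +ℕ e *ℕ Δ) *ℕ q      ≡⟨ ℕₚ.*-distribʳ-+ q (m *ℕ Δ ^ 2) (e *ℕ Δ) ⟩
      m *ℕ Δ ^ 2 *ℕ q +ℕ e *ℕ Δ *ℕ q   ≡⟨ cong (m *ℕ Δ ^ 2 *ℕ q +ℕ_) (lhs≡ e β δ Δ) ⟨
      m *ℕ Δ ^ 2 *ℕ q +ℕ lhs           ∎
      where open ℕₚ.≤-Reasoning

    lhs≤rhs : lhs ≤ℕ rhs
    lhs≤rhs = edge-term-≤ δ Δ β e δ≤Δ

    Zq≤N : Z *ℕ q ≤ℕ N
    Zq≤N = ℕₚ.≤-trans Zq≤ (ℕₚ.+-monoʳ-≤ (m *ℕ Δ ^ 2 *ℕ q) (ℕₚ.≤-trans lhs≤rhs (ℕₚ.≤-reflexive (rhs≡ (e ^ 2) β δ Δ))))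

    fwd : Z *ℕ q ≡ N → R
    fwd eq with edge-term-tight δ Δ β e δ≤Δ (ℕₚ.≤-antisym lhs≤rhs rhs≤lhs)
      where
      rhs≤lhs : rhs ≤ℕ lhs
      -- By `eq` the numerator `N` is at most the upper estimate in `Zq≤`; the common term mΔ²q
      -- cancels.
      rhs≤lhs = ℕₚ.≤-trans (ℕₚ.≤-reflexive (rhs≡ (e ^ 2) β δ Δ))
        (ℕₚ.+-cancelˡ-≤ (m *ℕ Δ ^ 2 *ℕ q) _ _ (ℕₚ.≤-trans (ℕₚ.≤-reflexive (sym eq)) Zq≤))
    ... | δ≡Δ , e≡βΔ = extremal⇒RBB δ≡Δ (trans e≡βΔ (cong (β *ℕ_) (sym δ≡Δ)))

    -- The scaled equality at n = 2β, m = β, δ = Δ and e = βΔ, with `b` for β and `D` for Δ.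
    extremal : ∀ b D → (b +ℕ b) *ℕ (D *ℕ (D *ℕ 1)) *ℕ (2 *ℕ b *ℕ (2 *ℕ D)) ≡
      b *ℕ (D *ℕ (D *ℕ 1)) *ℕ (2 *ℕ b *ℕ (2 *ℕ D)) +ℕ
        (b *ℕ D *ℕ (b *ℕ D *ℕ 1) *ℕ (2 *ℕ D) +ℕ b *ℕ (D *ℕ (D *ℕ (D *ℕ 1))) *ℕ (2 *ℕ b))
    extremal = solve-∀

    bwd : R → Z *ℕ q ≡ N
    bwd r with RBB⇒extremal r
    ... | δ≡Δ , e≡βδ , m≡β = begin
      Z *ℕ q
        ≡⟨ cong (_*ℕ q) (zagreb-regular δ≡Δ) ⟩
      n *ℕ Δ ^ 2 *ℕ q
        ≡⟨ cong₂ (λ k d → k *ℕ Δ ^ 2 *ℕ (2 *ℕ β *ℕ (2 *ℕ d))) (trans (sym β+[n∸β]≡n) (cong (β +ℕ_) m≡β)) δ≡Δ ⟩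
      (β +ℕ β) *ℕ Δ ^ 2 *ℕ (2 *ℕ β *ℕ (2 *ℕ Δ))
        ≡⟨ extremal β Δ ⟩
      value β Δ (β *ℕ Δ)
        ≡⟨ cong (value β Δ) (cong (β *ℕ_) δ≡Δ) ⟨
      value β Δ (β *ℕ δ)
        ≡⟨ cong₂ (λ k d → value k d (β *ℕ δ)) m≡β δ≡Δ ⟨
      value m δ (β *ℕ δ)
        ≡⟨ cong (value m δ) e≡βδ ⟨
      N ∎
      where
      open ≡-Reasoning
      -- `N` as a function of m, δ and e, so that each can be replaced separately.
      value : ℕ → ℕ → ℕ → ℕ
      value k d x = k *ℕ Δ ^ 2 *ℕ (2 *ℕ β *ℕ (2 *ℕ d)) +ℕ (x ^ 2 *ℕ (2 *ℕ d) +ℕ β *ℕ Δ ^ 3 *ℕ (2 *ℕ β))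

  -- Stated for any `x` below `𝒜` that agrees with `𝒜` on the extremal graphs, so that it covers
  -- both brackets.
  forgotten-bound : ∀ {x} → x ≤ 𝒜 → (R → x ≡ 𝒜) →
    let bound = ι m * ι (δ ^ 3) + (ι δ ÷ℕ β) * x in
    bound ≤ ι (forgotten G) × (ι (forgotten G) ≡ bound ⇔ R)
  forgotten-bound {x} x≤A R⇒x≡A = affine-bound (ι m * ι (δ ^ 3)) (ι δ ÷ℕ β) x α₂
    (pos*pos⇒pos (ι δ) {{ι-pos δ}} (ℤ.+ 1 / β) {{1/-pos β}})
    (≤-trans x≤A A≤α₂)
    (≤-trans (≤-reflexive affine) (ι-mono-≤ forgotten-≥))
    -- `F` = nδ³ gives δ = Δ, and x = α₂ squeezes `𝒜` onto `α₂`, which gives e = βδ.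
    (λ x≡α F≡ → extremal⇒RBB
      (forgotten-tight (ι-injective (trans F≡ affine)))
      (A≡α⇒e≡βδ β δ e (≤-antisym A≤α₂ (≤-trans (≤-reflexive (sym x≡α)) x≤A))))
    (λ r → trans (R⇒x≡A r) (R⇒A≡α₂ r) ,
           trans (cong ι (forgotten-regular (proj₁ (RBB⇒extremal r)))) (sym affine))
    where
    affine : ι m * ι (δ ^ 3) + (ι δ ÷ℕ β) * α₂ ≡ ι (n *ℕ δ ^ 3)
    affine = trans (forgotten-affine m β δ) (cong (λ k → ι (k *ℕ δ ^ 3)) β+[n∸β]≡n)

  inverse-bound : ∀ {x} → x ≤ 𝒜 → (R → x ≡ 𝒜) →
    let bound = ι m ÷ℕ Δ + (ι 1 ÷ℕ (β *ℕ Δ ^ 3)) * x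
        Inv = inverseDegree G (degree≢0 G minδ 1≤δ) in
    bound ≤ Inv × (Inv ≡ bound ⇔ R)
  inverse-bound {x} x≤A R⇒x≡A = affine-bound (ι m ÷ℕ Δ) (ι 1 ÷ℕ (β *ℕ Δ ^ 3)) x α₄
    (pos*pos⇒pos (ι 1) {{ι-pos 1}} (ℤ.+ 1 / (β *ℕ Δ ^ 3)) {{1/-pos (β *ℕ Δ ^ 3)}})
    (≤-trans x≤A (≤-trans A≤α₂ α₂≤α₄))
    (≤-trans (≤-reflexive affine) inverse-≥)
    (λ x≡α _ → fwd x≡α)
    (λ r → trans (R⇒x≡A r) (trans (R⇒A≡α₂ r) (R⇒α₂≡α₄ r)) , trans (inverse-regular r) (sym affine))
    where
    affine : ι m ÷ℕ Δ + (ι 1 ÷ℕ (β *ℕ Δ ^ 3)) * α₄ ≡ ι n ÷ℕ Δ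
    affine = trans (inverse-affine m β Δ) (cong (λ k → ι k ÷ℕ Δ) β+[n∸β]≡n)
    instance
      nzd : ∀ {u} → NonZero (degree G u)
      nzd {u} = degree≢0 G minδ 1≤δ u
    inverse-≥ : ι n ÷ℕ Δ ≤ inverseDegree G (degree≢0 G minδ 1≤δ)
    inverse-≥ = ≤-trans (≤-reflexive (sym (∑ℚ-const n (ℤ.+ 1 / Δ)))) (∑ℚ-mono-≤ λ u → 1/-antimono-≤ (proj₂ maxΔ u))
    inverse-regular : R → inverseDegree G (degree≢0 G minδ 1≤δ) ≡ ι n ÷ℕ Δ
    inverse-regular r = trans (sum-cong-≗ pointwise) (∑ℚ-const n (ℤ.+ 1 / Δ))
      where
      pointwise : ∀ u → ℤ.+ 1 / degree G u ≡ ℤ.+ 1 / Δ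
      pointwise u = ≤-antisym
        (1/-antimono-≤ (ℕₚ.≤-trans (ℕₚ.≤-reflexive (sym (proj₁ (RBB⇒extremal r)))) (proj₂ minδ u)))
        (1/-antimono-≤ (proj₂ maxΔ u))
    -- Equality collapses the chain x ≤ 𝒜 ≤ α₂ ≤ α₄: from 𝒜 = α₂ comes e = βδ, and from α₂ = α₄
    -- comes δ = Δ.
    fwd : x ≡ α₄ → R
    fwd x≡α₄ = extremal⇒RBB (ℕₚ.*-cancelˡ-≡ δ Δ β (square-injective (ι-injective α₂≡α₄))) (A≡α⇒e≡βδ β δ e A≡α₂)
      where
      α₄≤A : α₄ ≤ 𝒜
      α₄≤A = ≤-trans (≤-reflexive (sym x≡α₄)) x≤A
      A≡α₂ : 𝒜 ≡ α₂
      A≡α₂ = ≤-antisym A≤α₂ (≤-trans α₂≤α₄ α₄≤A)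
      α₂≡α₄ : α₂ ≡ α₄
      α₂≡α₄ = ≤-antisym α₂≤α₄ (≤-trans α₄≤A A≤α₂)

  forgotten-bound₂ : let bound = ι m * ι (δ ^ 3) + (ι δ * 𝒜) ÷ℕ β in
    bound ≤ ι (forgotten G) × (ι (forgotten G) ≡ bound ⇔ R)
  forgotten-bound₂ = subst (λ b → ι m * ι (δ ^ 3) + b ≤ F × (F ≡ ι m * ι (δ ^ 3) + b ⇔ R))
    -- Moves the bracket from beside the fraction δ/β into its numerator.
    (solve 3 (λ d a i → d :* i :* a := d :* a :* i) refl (ι δ) 𝒜 (ℤ.+ 1 / β))
    (forgotten-bound ≤-refl (λ _ → refl))
    where F = ι (forgotten G)

  forgotten-bound₃ : let bound = ι m * ι (δ ^ 3) + (ι δ ÷ℕ β) * ℬ in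
    bound ≤ ι (forgotten G) × (ι (forgotten G) ≡ bound ⇔ R)
  forgotten-bound₃ = forgotten-bound ℬ≤𝒜 R⇒B≡A

  inverse-bound₄ : let bound = ι m ÷ℕ Δ + 𝒜 ÷ℕ (β *ℕ Δ ^ 3)
                       Inv = inverseDegree G (degree≢0 G minδ 1≤δ) in
    bound ≤ Inv × (Inv ≡ bound ⇔ R)
  inverse-bound₄ = subst (λ b → ι m ÷ℕ Δ + b ≤ Inv × (Inv ≡ ι m ÷ℕ Δ + b ⇔ R))
    (trans (cong (_* 𝒜) (*-identityˡ (ℤ.+ 1 / (β *ℕ Δ ^ 3)))) (*-comm (ℤ.+ 1 / (β *ℕ Δ ^ 3)) 𝒜))
    (inverse-bound ≤-refl (λ _ → refl))
    where Inv = inverseDegree G (degree≢0 G minδ 1≤δ)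

  inverse-bound₅ : let bound = ι m ÷ℕ Δ + (ι 1 ÷ℕ (β *ℕ Δ ^ 3)) * ℬ
                       Inv = inverseDegree G (degree≢0 G minδ 1≤δ) in
    bound ≤ Inv × (Inv ≡ bound ⇔ R)
  inverse-bound₅ = inverse-bound ℬ≤𝒜 R⇒B≡A

theorem1 : ∀ {n : ℕ} (G : SimpleGraph n) (e δ Δ β : ℕ) →
  e ≡ numEdges G →
  (minδ : IsMinDegree G δ) (1≤δ : 1 ≤ℕ δ) →
  (maxΔ : IsMaxDegree G Δ) →
  (indβ : IsIndependenceNumber G β) →
  let
    instance
      nzδ : NonZero δ
      nzδ = δ≢0 G minδ 1≤δ
      nzΔ : NonZero Δ
      nzΔ = Δ≢0 G minδ 1≤δ maxΔ
      nzβ : NonZero β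
      nzβ = β≢0 G minδ 1≤δ indβ
      nzn∸β : NonZero (n ∸ β)
      nzn∸β = n∸β≢0 G minδ 1≤δ indβ
      nz2β : NonZero (2 *ℕ β)
      nz2β = m*n≢0 2 β
      nz2δ : NonZero (2 *ℕ δ)
      nz2δ = m*n≢0 2 δ
      nzΔ³ : NonZero (Δ ^ 3)
      nzΔ³ = m^n≢0 Δ 3
      nzβΔ³ : NonZero (β *ℕ Δ ^ 3)
      nzβΔ³ = m*n≢0 β (Δ ^ 3)
    Z₁ : ℚ
    Z₁ = ι (firstZagreb G)
    F : ℚ
    F = ι (forgotten G)
    Inv : ℚ
    Inv = inverseDegree G (degree≢0 G minδ 1≤δ)
    bound₁ : ℚ
    bound₁ = ι (n ∸ β) * ι (Δ ^ 2) + ι (e ^ 2) ÷ℕ (2 *ℕ β) + (ι β * ι (Δ ^ 3)) ÷ℕ (2 *ℕ δ)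
    A : ℚ
    A = ι 2 * ι (β ^ 2) * ι (δ ^ 2) - ι (e ^ 2)
    B : ℚ
    B = ι 2 * ι β * (ι β * ι (δ ^ 2) + ι (e ^ 2) ÷ℕ (n ∸ β)) - ι (e ^ 2) - ι 2 * ι β * ι (n ∸ β) * ι (Δ ^ 2)
    bound₂ : ℚ
    bound₂ = ι (n ∸ β) * ι (δ ^ 3) + (ι δ * A) ÷ℕ β
    bound₃ : ℚ
    bound₃ = ι (n ∸ β) * ι (δ ^ 3) + (ι δ ÷ℕ β) * B
    bound₄ : ℚ
    bound₄ = ι (n ∸ β) ÷ℕ Δ + A ÷ℕ (β *ℕ Δ ^ 3)
    bound₅ : ℚ
    bound₅ = ι (n ∸ β) ÷ℕ Δ + (ι 1 ÷ℕ (β *ℕ Δ ^ 3)) * B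
  in
    (Z₁ ≤ bound₁ × (Z₁ ≡ bound₁ ⇔ RegularBalancedBipartite G))
  × (bound₂ ≤ F × (F ≡ bound₂ ⇔ RegularBalancedBipartite G))
  × (bound₃ ≤ F × (F ≡ bound₃ ⇔ RegularBalancedBipartite G))
  × (bound₄ ≤ Inv × (Inv ≡ bound₄ ⇔ RegularBalancedBipartite G))
  × (bound₅ ≤ Inv × (Inv ≡ bound₅ ⇔ RegularBalancedBipartite G))
theorem1 G e δ Δ β refl minδ 1≤δ maxΔ indβ =
  zagreb-bound , forgotten-bound₂ , forgotten-bound₃ , inverse-bound₄ , inverse-bound₅
  where open Bounds G minδ 1≤δ maxΔ indβ
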